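{- For every integer $k\ge 2$ there exists an infinite sequence $(\mathcal{H}_i)_{i\ge 1}$ of $k$-uniform hypertrees, where $\mathcal{H}_i$ has $n_i$ vertices and $e_i$ edges, such that the sequence $(n_i)$ is strictly increasing and $e_i/\binom{n_i}{k-1}\to 1$ as $i\to\infty$.
   Context: A $k$-uniform hypergraph $\mathcal{H}=(V,\mathcal{E})$ consists of a finite vertex set $V$ and a set $\mathcal{E}$ of $k$-element subsets of $V$ (no multiple edges). A $k$-uniform hypergraph is a chain if there is a sequence $v_1,\dots,v_l$ of its vertices in which every vertex appears at least once (possibly more times), $v_1\ne v_l$, and its edge set consists of exactly the $l-k+1$ distinct sets $\{v_i,v_{i+1},\dots,v_{i+k-1}\}$, $1\le i\le l-k+1$. It is a semicycle if the same holds but with $v_1=v_l$ instead of $v_1\neq v_l$. The length of a chain or semicycle is its number of edges. $\mathcal{H}$ is chain-connected if every pair of distinct vertices is contained in some subhypergraph of $\mathcal{H}$ that is a chain; it is semicycle-free if no subhypergraph of $\mathcal{H}$ is a semicycle. A $k$-uniform hypertree is a $k$-uniform hypergraph that is chain-connected and semicycle-free. -}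

module Defs where

open import Data.Nat using (ℕ; suc; _∸_; _≤_)
open import Data.Fin using (Fin)
open import Data.Fin.Subset using (Subset; ⁅_⁆; _∪_; ⊥; ∣_∣)
open import Data.List using (List; []; _∷_; length; map; take; drop; upTo; foldr; head; last)
open import Data.List.Relation.Unary.All using (All)
open import Data.List.Relation.Unary.Unique.Propositional using (Unique)
open import Data.List.Membership.Propositional using (_∈_)
open import Data.Product using (_×_; ∃)
open import Relation.Binary.PropositionalEquality using (_≡_; _≢_)
open import Relation.Nullary using (¬_)

record Hypergraph (k n : ℕ) : Set where
  field
    edges        : List (Subset n)
    edges-unique : Unique edges
    edges-size   : All (λ e → ∣ e ∣ ≡ k) edges
open Hypergraph public

toSubset : {n : ℕ} → List (Fin n) → Subset n
toSubset = foldr (λ v s → ⁅ v ⁆ ∪ s) ⊥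

windows : {n : ℕ} → ℕ → List (Fin n) → List (Subset n)
windows k vs = map (λ i → toSubset (take k (drop i vs))) (upTo (suc (length vs ∸ k)))

-- vs is a vertex sequence of length l ≥ k whose l-k+1 windows are pairwise
-- distinct edges of H.  The subhypergraph of H with vertex set {vs} and edge set
-- (windows k vs) is then a chain (if head ≢ last) or semicycle (if head ≡ last);
-- conversely every chain / semicycle subhypergraph arises this way.
IsWindowSeq : {k n : ℕ} → Hypergraph k n → List (Fin n) → Set
IsWindowSeq {k} H vs = k ≤ length vs × Unique (windows k vs) × All (_∈ edges H) (windows k vs)

IsChainSeq : {k n : ℕ} → Hypergraph k n → List (Fin n) → Set
IsChainSeq H vs = IsWindowSeq H vs × head vs ≢ last vs

IsSemicycleSeq : {k n : ℕ} → Hypergraph k n → List (Fin n) → Set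
IsSemicycleSeq H vs = IsWindowSeq H vs × head vs ≡ last vs

ChainConnected : {k n : ℕ} → Hypergraph k n → Set
ChainConnected {n = n} H = (u v : Fin n) → u ≢ v → ∃ λ vs → IsChainSeq H vs × u ∈ vs × v ∈ vs

SemicycleFree : {k n : ℕ} → Hypergraph k n → Set
SemicycleFree {n = n} H = (vs : List (Fin n)) → ¬ IsSemicycleSeq H vs

IsHypertree : {k n : ℕ} → Hypergraph k n → Set
IsHypertree H = ChainConnected H × SemicycleFree H

{-# OPTIONS --safe #-}
module Submission where

-- Put r = k − 1.  Take r core vertices, a blocks of b vertices each, and one apex for every
-- r-set of blocks.  The edges are the stars, consisting of the core and one further vertex, and
-- (if r ≥ 2) the cones, consisting of one vertex from each of r blocks together with the apex of
-- that r-set of blocks.  Any two vertices lie on a chain of at most two stars.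
--
-- Consecutive edges of a chain share r vertices, so stars and cones do not mix; three
-- consecutive edges cannot all be stars, as the first two vertices would both lie outside the
-- core.  When one cone follows another, the apex is never the vertex dropped, since the other r
-- vertices determine it; hence the dropped and the added vertex lie in the same block.  In a
-- semicycle v … a M v this puts a and v in one block.  If a and v = v₁ lie in the first cone this is
-- impossible; otherwise the sequence is so long that the apex of the first cone gets dropped.
--
-- There are C(a,r) b^r cones, and b is chosen so large that n ≤ (a+1) b, whence
-- C(a,r) b^r / C(n,r) ≥ ((a−r)/(a+1))^r → 1, while the n − r stars are negligible.

open import Defs
open import Data.Empty as Empty using ()
open import Data.Fin using (Fin; zero; suc; _↑ˡ_; _↑ʳ_; splitAt; combine; remQuot; finToFun; funToFin; fromℕ<)
open import Data.Fin.Properties as Fin using (splitAt-↑ˡ; splitAt-↑ʳ; splitAt⁻¹-↑ˡ; splitAt⁻¹-↑ʳ; ↑ˡ-injective; ↑ʳ-injective; combine-injective; remQuot-combine; finToFun-funToFin; funToFin-finToFin)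
open import Data.Fin.Subset using (Subset; ⁅_⁆; _∪_; ∣_∣; inside; outside) renaming (_∈_ to _∈ˢ_; _∉_ to _∉ˢ_)
open import Data.Fin.Subset.Properties using (∉⊥; x∈⁅x⁆; x∈⁅y⁆⇒x≡y; x∈p∪q⁻; x∈p∪q⁺; ⊆-antisym; ∣⊥∣≡0; ∪-identityˡ; _∈?_)
open import Data.List using (List; []; _∷_; _++_; _∷ʳ_; [_]; length; map; take; drop; upTo; head; last; initLast; _∷ʳ′_; tabulate; allFin; cartesianProductWith)
open import Data.List.Properties using (++-assoc; ++-identityʳ; length-++; length-map; length-tabulate; length-take; length-drop; take-all; take++drop≡id; ∷ʳ-++)
open import Data.List.Membership.Propositional using (_∈_; _∉_)
open import Data.List.Membership.Propositional.Properties using (∈-++⁻; ∈-++⁺ˡ; ∈-++⁺ʳ; ∈-map⁺; ∈-map⁻; ∈-upTo⁺; ∈-∃++; ∈-tabulate⁺; ∈-tabulate⁻; ∈-cartesianProductWith⁻; ∈-allFin)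
open import Data.List.Relation.Unary.All as All using (All; []; _∷_)
import Data.List.Relation.Unary.All.Properties as All
open import Data.List.Relation.Unary.AllPairs using ([]; _∷_)
open import Data.List.Relation.Unary.Any using (here; there)
open import Data.List.Relation.Unary.Unique.Propositional using (Unique)
open import Data.List.Relation.Unary.Unique.Propositional.Properties as Unique using (Unique[x∷xs]⇒x∉xs)
open import Data.Maybe using (Maybe; just; nothing)
open import Data.Maybe.Properties using (just-injective)
open import Data.Nat
open import Data.Nat.Combinatorics using (_C_; nCk+nC[k+1]≡[n+1]C[k+1]; nC1≡n)
open import Data.Nat.Properties
open import Data.Nat.Solver using (module +-*-Solver)
open import Data.Product using (Σ; ∃; ∃₂; ∃-syntax; _×_; _,_; proj₁; proj₂)
open import Data.Sum using (_⊎_; inj₁; inj₂; [_,_]′)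
open import Data.Vec using (_∷_; here; there)
open import Function using (_∘_; id; const)
open import Relation.Binary.Definitions using (tri<; tri≈; tri>)
open import Relation.Binary.PropositionalEquality hiding ([_])
open import Relation.Nullary using (¬_; yes; no; contradiction)
open +-*-Solver using (solve; _:=_; _:+_; _:*_; con)

-- Lists of vertices and their windows

∈-toSubset⁺ : ∀ {n} {v : Fin n} {xs} → v ∈ xs → v ∈ˢ toSubset xs
∈-toSubset⁺ {v = v} (here refl) = x∈p∪q⁺ (inj₁ (x∈⁅x⁆ v))
∈-toSubset⁺ (there v∈xs) = x∈p∪q⁺ (inj₂ (∈-toSubset⁺ v∈xs))

∈-toSubset⁻ : ∀ {n} {v : Fin n} xs → v ∈ˢ toSubset xs → v ∈ xs
∈-toSubset⁻ []       v∈ = contradiction v∈ ∉⊥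
∈-toSubset⁻ (x ∷ xs) v∈ with x∈p∪q⁻ ⁅ x ⁆ (toSubset xs) v∈
... | inj₁ v∈⁅x⁆ = here (x∈⁅y⁆⇒x≡y x v∈⁅x⁆)
... | inj₂ v∈xs  = there (∈-toSubset⁻ xs v∈xs)

toSubset-⊆ : ∀ {n} {v : Fin n} {xs ys} → toSubset xs ≡ toSubset ys → v ∈ xs → v ∈ ys
toSubset-⊆ {v = v} {ys = ys} eq v∈xs = ∈-toSubset⁻ ys (subst (v ∈ˢ_) eq (∈-toSubset⁺ v∈xs))

toSubset-cong : ∀ {n} {xs ys : List (Fin n)} → (∀ {v} → v ∈ xs → v ∈ ys) →
  (∀ {v} → v ∈ ys → v ∈ xs) → toSubset xs ≡ toSubset ys
toSubset-cong {xs = xs} {ys} xs⊆ys ys⊆xs =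
  ⊆-antisym (∈-toSubset⁺ ∘ xs⊆ys ∘ ∈-toSubset⁻ xs) (∈-toSubset⁺ ∘ ys⊆xs ∘ ∈-toSubset⁻ ys)

∣⁅v⁆∪p∣ : ∀ {n} (v : Fin n) (p : Subset n) → v ∉ˢ p → ∣ ⁅ v ⁆ ∪ p ∣ ≡ suc ∣ p ∣
∣⁅v⁆∪p∣ zero    (inside  ∷ p) v∉p = contradiction here v∉p
∣⁅v⁆∪p∣ zero    (outside ∷ p) v∉p = cong (suc ∘ ∣_∣) (∪-identityˡ p)
∣⁅v⁆∪p∣ (suc v) (inside  ∷ p) v∉p = cong suc (∣⁅v⁆∪p∣ v p (v∉p ∘ there))
∣⁅v⁆∪p∣ (suc v) (outside ∷ p) v∉p = ∣⁅v⁆∪p∣ v p (v∉p ∘ there)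

∣toSubset∣ : ∀ {n} {xs : List (Fin n)} → Unique xs → ∣ toSubset xs ∣ ≡ length xs
∣toSubset∣ {n} [] = ∣⊥∣≡0 n
∣toSubset∣ {xs = x ∷ xs} u@(_ ∷ u′) =
  trans (∣⁅v⁆∪p∣ x (toSubset xs) (Unique[x∷xs]⇒x∉xs u ∘ ∈-toSubset⁻ xs)) (cong suc (∣toSubset∣ u′))

∉⇒All≢ : ∀ {A : Set} {x : A} {xs} → x ∉ xs → All (x ≢_) xs
∉⇒All≢ {xs = []}     x∉xs = []
∉⇒All≢ {xs = y ∷ ys} x∉xs = (x∉xs ∘ here) ∷ ∉⇒All≢ (x∉xs ∘ there)

x∈p⇒⁅x⁆∪p≡p : ∀ {n} {v : Fin n} {p : Subset n} → v ∈ˢ p → ⁅ v ⁆ ∪ p ≡ p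
x∈p⇒⁅x⁆∪p≡p {v = v} {p} v∈p = ⊆-antisym ⊆₁ (x∈p∪q⁺ ∘ inj₂)
  where
  ⊆₁ : ∀ {u} → u ∈ˢ ⁅ v ⁆ ∪ p → u ∈ˢ p
  ⊆₁ u∈ with x∈p∪q⁻ ⁅ v ⁆ p u∈
  ... | inj₁ u∈⁅v⁆ = subst (_∈ˢ p) (sym (x∈⁅y⁆⇒x≡y v u∈⁅v⁆)) v∈p
  ... | inj₂ u∈p   = u∈p

∣toSubset∣≤length : ∀ {n} (xs : List (Fin n)) → ∣ toSubset xs ∣ ≤ length xs
∣toSubset∣≤length {n} []   = ≤-reflexive (∣⊥∣≡0 n)
∣toSubset∣≤length (x ∷ xs) with x ∈? toSubset xs
... | yes x∈ = ≤-trans (≤-reflexive (cong ∣_∣ (x∈p⇒⁅x⁆∪p≡p x∈))) (m≤n⇒m≤1+n (∣toSubset∣≤length xs))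
... | no  x∉ = ≤-trans (≤-reflexive (∣⁅v⁆∪p∣ x _ x∉)) (s≤s (∣toSubset∣≤length xs))

-- A repeated entry would make the set smaller than the list. Applied to windows, whose sets are
-- edges of full size.
length≤∣toSubset∣⇒Unique : ∀ {n} (xs : List (Fin n)) → length xs ≤ ∣ toSubset xs ∣ → Unique xs
length≤∣toSubset∣⇒Unique []       _   = []
length≤∣toSubset∣⇒Unique (x ∷ xs) len with x ∈? toSubset xs
... | yes x∈ = contradiction (≤-trans len (≤-trans (≤-reflexive (cong ∣_∣ (x∈p⇒⁅x⁆∪p≡p x∈))) (∣toSubset∣≤length xs))) 1+n≰n
... | no  x∉ = ∉⇒All≢ (x∉ ∘ ∈-toSubset⁺)
             ∷ length≤∣toSubset∣⇒Unique xs (≤-pred (≤-trans len (≤-reflexive (∣⁅v⁆∪p∣ x _ x∉))))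

∷ʳ⇒∷-⊆ : ∀ {A : Set} {u v : A} {M} → u ∈ M ∷ʳ v → u ∈ v ∷ M
∷ʳ⇒∷-⊆ {M = M} u∈ with ∈-++⁻ M u∈
... | inj₁ u∈M         = there u∈M
... | inj₂ (here refl) = here refl

∷⇒∷ʳ-⊆ : ∀ {A : Set} {u v : A} {M} → u ∈ v ∷ M → u ∈ M ∷ʳ v
∷⇒∷ʳ-⊆ {M = M} (here refl)  = ∈-++⁺ʳ M (here refl)
∷⇒∷ʳ-⊆         (there u∈M)  = ∈-++⁺ˡ u∈M

-- If the vertex that enters a window equals the one that has just left, the edge stays the same;
-- distinctness of the windows forbids this.
toSubset-rotate : ∀ {n} (v : Fin n) M → toSubset (v ∷ M) ≡ toSubset (M ∷ʳ v)
toSubset-rotate v M = toSubset-cong {xs = v ∷ M} {M ∷ʳ v} ∷⇒∷ʳ-⊆ ∷ʳ⇒∷-⊆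

length-∷ʳ : ∀ {A : Set} (M : List A) v → length (M ∷ʳ v) ≡ suc (length M)
length-∷ʳ M v = trans (length-++ M) (+-comm (length M) 1)

shift-window : ∀ {A : Set} {vs} P (u : A) M v Q → vs ≡ P ++ u ∷ M ++ v ∷ Q →
  vs ≡ (P ∷ʳ u) ++ (M ∷ʳ v) ++ Q
shift-window P u M v Q eq =
  trans eq (trans (cong (λ xs → P ++ u ∷ xs) (sym (∷ʳ-++ M v Q))) (sym (∷ʳ-++ P u _)))

last-∷ʳ : ∀ {A : Set} (xs : List A) v → last (xs ∷ʳ v) ≡ just v
last-∷ʳ []           v = refl
last-∷ʳ (x ∷ [])     v = refl
last-∷ʳ (x ∷ y ∷ xs) v = last-∷ʳ (y ∷ xs) v

take-drop-middle : ∀ {A : Set} (P M Q : List A) → take (length M) (drop (length P) (P ++ M ++ Q)) ≡ M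
take-drop-middle (p ∷ P) M       Q = take-drop-middle P M Q
take-drop-middle []      []      Q = refl
take-drop-middle []      (m ∷ M) Q = cong (m ∷_) (take-drop-middle [] M Q)

Unique-map⇒injective : ∀ {A B : Set} (f : A → B) {xs i j} → Unique (map f xs) →
  i ∈ xs → j ∈ xs → f i ≡ f j → i ≡ j
Unique-map⇒injective f u@(_ ∷ _) (here refl) (here refl) _  = refl
Unique-map⇒injective f {_ ∷ xs} u@(_ ∷ _) (here refl) (there j∈)  eq =
  contradiction (subst (_∈ map f xs) (sym eq) (∈-map⁺ f j∈)) (Unique[x∷xs]⇒x∉xs u)
Unique-map⇒injective f {_ ∷ xs} u@(_ ∷ _) (there i∈)  (here refl) eq =
  contradiction (subst (_∈ map f xs) eq (∈-map⁺ f i∈)) (Unique[x∷xs]⇒x∉xs u)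
Unique-map⇒injective f (_ ∷ u)   (there i∈)  (there j∈)  eq = Unique-map⇒injective f u i∈ j∈ eq

split : ∀ {A : Set} m (xs : List A) → m ≤ length xs → ∃₂ λ M Q → xs ≡ M ++ Q × length M ≡ m
split m xs m≤ = take m xs , drop m xs , sym (take++drop≡id m xs) ,
  trans (length-take m xs) (m≤n⇒m⊓n≡m m≤)

splitEnd : ∀ {A : Set} m (xs : List A) → m ≤ length xs → ∃₂ λ P R → xs ≡ P ++ R × length R ≡ m
splitEnd m xs m≤ = take (length xs ∸ m) xs , drop (length xs ∸ m) xs ,
  sym (take++drop≡id (length xs ∸ m) xs) ,
  trans (length-drop (length xs ∸ m) xs) (m∸[m∸n]≡n m≤)

splitAround : ∀ {A : Set} m (xs : List A) → m < length xs →
  ∃[ M ] ∃[ b ] ∃[ Q ] xs ≡ M ++ b ∷ Q × length M ≡ m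
splitAround zero    (x ∷ xs) _        = [] , x , xs , refl , refl
splitAround (suc m) (x ∷ xs) (s≤s m<) =
  let M , b , Q , eq , len = splitAround m xs m< in x ∷ M , b , Q , cong (x ∷_) eq , cong suc len

windowAt : ∀ {n} → ℕ → List (Fin n) → ℕ → Subset n
windowAt k vs i = toSubset (take k (drop i vs))

windowAt-middle : ∀ {n k vs} (P M Q : List (Fin n)) → vs ≡ P ++ M ++ Q → length M ≡ k →
  windowAt k vs (length P) ≡ toSubset M
windowAt-middle P M Q refl refl = cong toSubset (take-drop-middle P M Q)

middle∈upTo : ∀ {A : Set} {k vs} (P M Q : List A) → vs ≡ P ++ M ++ Q → length M ≡ k →
  length P ∈ upTo (suc (length vs ∸ k))
middle∈upTo P M Q refl refl = ∈-upTo⁺ (s≤s (≤-trans (m≤m+n (length P) (length Q)) (≤-reflexive (begin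
  length P + length Q                          ≡⟨ m+n∸n≡m _ (length M) ⟨
  length P + length Q + length M ∸ length M    ≡⟨ cong (_∸ length M) (trans (+-assoc (length P) _ _) (cong (length P +_) (+-comm (length Q) _))) ⟩
  length P + (length M + length Q) ∸ length M  ≡⟨ cong (_∸ length M) (trans (length-++ P) (cong (length P +_) (length-++ M))) ⟨
  length (P ++ M ++ Q) ∸ length M              ∎))))
  where open ≡-Reasoning

windows-single : ∀ {n k} (vs : List (Fin n)) → length vs ≡ k → windows k vs ≡ [ toSubset vs ]
windows-single vs refl rewrite n∸n≡0 (length vs) | take-all (length vs) vs ≤-refl = refl

windows-pair : ∀ {n r} (u : Fin n) M v → length M ≡ r →
  windows (suc r) (u ∷ M ∷ʳ v) ≡ toSubset (u ∷ M) ∷ toSubset (M ∷ʳ v) ∷ []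
windows-pair u M v refl
  rewrite length-∷ʳ M v
        | m+n∸n≡m 1 (length M)
        | take-drop-middle [] M [ v ]
        | take-all (suc (length M)) (M ∷ʳ v) (≤-reflexive (length-∷ʳ M v)) = refl

-- Tours: sequences whose windows are edges

-- Windows are given by decompositions of the list instead of positions, which makes overlaps
-- explicit. `E` is a parameter so that membership in the edge list can be replaced by the shape of
-- the edge.
record Tour {n} (E : List (Fin n) → Set) (r : ℕ) (vs : List (Fin n)) : Set where
  field
    edge     : ∀ P M Q → vs ≡ P ++ M ++ Q → length M ≡ suc r → E M × Unique M
    distinct : ∀ P a M b Q → vs ≡ P ++ a ∷ M ++ b ∷ Q → length M ≡ r →
               toSubset (a ∷ M) ≢ toSubset (M ∷ʳ b)
open Tour

tour-tail : ∀ {n E r} {v : Fin n} {vs} → Tour E r (v ∷ vs) → Tour E r vs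
tour-tail {v = v} t .edge     P M Q     eq = edge t (v ∷ P) M Q (cong (v ∷_) eq)
tour-tail {v = v} t .distinct P a M b Q eq = distinct t (v ∷ P) a M b Q (cong (v ∷_) eq)

windowSeq⇒tour : ∀ {r n} (H : Hypergraph (suc r) n) {vs} → IsWindowSeq H vs →
  Tour (λ xs → toSubset xs ∈ edges H) r vs
windowSeq⇒tour {r} H {vs} (_ , uniq , allE) = record { edge = edge′ ; distinct = distinct′ }
  where
  edge′ : ∀ P M Q → vs ≡ P ++ M ++ Q → length M ≡ suc r → toSubset M ∈ edges H × Unique M
  edge′ P M Q eq len = M∈E , length≤∣toSubset∣⇒Unique M
      (≤-reflexive (trans len (sym (All.lookup (edges-size H) M∈E))))
    where
    M∈E : toSubset M ∈ edges H
    M∈E = All.lookup allE (subst (_∈ windows (suc r) vs) (windowAt-middle P M Q eq len)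
      (∈-map⁺ (windowAt (suc r) vs) (middle∈upTo P M Q eq len)))
  distinct′ : ∀ P a M b Q → vs ≡ P ++ a ∷ M ++ b ∷ Q → length M ≡ r →
    toSubset (a ∷ M) ≢ toSubset (M ∷ʳ b)
  -- The two windows start at positions `length P` and `length P + 1`, which equality of the windows
  -- would identify.
  distinct′ P a M b Q eq len same = 1+n≢n (trans (sym (length-∷ʳ P a)) (sym
      (Unique-map⇒injective (windowAt (suc r) vs) uniq
        (middle∈upTo P (a ∷ M) (b ∷ Q) eq (cong suc len))
        (middle∈upTo (P ∷ʳ a) (M ∷ʳ b) Q eq′ len′)
        (begin
          windowAt (suc r) vs (length P)        ≡⟨ windowAt-middle P (a ∷ M) (b ∷ Q) eq (cong suc len) ⟩
          toSubset (a ∷ M)                      ≡⟨ same ⟩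
          toSubset (M ∷ʳ b)                     ≡⟨ windowAt-middle (P ∷ʳ a) (M ∷ʳ b) Q eq′ len′ ⟨
          windowAt (suc r) vs (length (P ∷ʳ a)) ∎))))
    where
    open ≡-Reasoning
    len′ : length (M ∷ʳ b) ≡ suc r
    len′ = trans (length-∷ʳ M b) (cong suc len)
    eq′ : vs ≡ (P ∷ʳ a) ++ (M ∷ʳ b) ++ Q
    eq′ = shift-window P a M b Q eq

-- A closed sequence of length k repeats a vertex inside a window, and one of length k + 1 has two
-- equal windows.
closedTour : ∀ {r n} {E : List (Fin n) → Set} {vs} → Tour E (suc r) vs → suc (suc r) ≤ length vs →
  head vs ≡ last vs →
  ∃[ v ] ∃[ P ] ∃[ a ] ∃[ M ] vs ≡ v ∷ P ++ a ∷ M ++ [ v ] × length M ≡ suc r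
closedTour {r} {vs = v ∷ vs} t k≤ closed with initLast vs
closedTour {r} {vs = v ∷ .[]} t (s≤s ()) closed | []
... | W ∷ʳ′ w with trans closed (last-∷ʳ (v ∷ W) w)
... | refl with <-cmp (length W) (suc r)
... | tri< |W|<r _ _ = contradiction (∈-++⁺ʳ W (here refl)) (Unique[x∷xs]⇒x∉xs
        (proj₂ (edge t [] (v ∷ W ∷ʳ v) [] (cong (v ∷_) (sym (++-identityʳ (W ∷ʳ v))))
          (≤-antisym (s≤s (≤-trans (≤-reflexive (length-∷ʳ W v)) |W|<r)) k≤))))
... | tri≈ _ |W|≡r _ = contradiction (toSubset-rotate v W) (distinct t [] v W v [] refl |W|≡r)
... | tri> _ _ r<|W| =
  let P , R , W≡ , |R| = splitEnd (suc (suc r)) W r<|W| in finish P R W≡ |R|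
  where
  finish : ∀ P R → W ≡ P ++ R → length R ≡ suc (suc r) →
    ∃[ v′ ] ∃[ P ] ∃[ a ] ∃[ M ] v ∷ W ++ [ v ] ≡ v′ ∷ P ++ a ∷ M ++ [ v′ ] × length M ≡ suc r
  finish P (a ∷ M) refl len = v , P , a , M , cong (v ∷_) (++-assoc P (a ∷ M) [ v ]) , suc-injective len

-- Subsets of fixed size, and functions coded as numbers

-- An r-element subset of Fin a: scan 0, 1, … and take or skip each point.
data Choice : ℕ → ℕ → Set where
  stop : ∀ {a} → Choice 0 a
  pick : ∀ {r a} → Choice r a → Choice (suc r) (suc a)
  skip : ∀ {r a} → Choice (suc r) a → Choice (suc r) (suc a)

chosen : ∀ {r a} → Choice r a → Fin r → Fin a
chosen (pick T) zero    = zero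
chosen (pick T) (suc i) = suc (chosen T i)
chosen (skip T) i       = suc (chosen T i)

chosen-injective : ∀ {r a} (T : Choice r a) {i j} → chosen T i ≡ chosen T j → i ≡ j
chosen-injective (pick T) {zero}  {zero}  _  = refl
chosen-injective (pick T) {suc i} {suc j} eq = cong suc (chosen-injective T (Fin.suc-injective eq))
chosen-injective (skip T) eq = chosen-injective T (Fin.suc-injective eq)

-- Inclusion of the chosen sets. Positions may differ, since a window lists its vertices in any
-- order.
_⊑_ : ∀ {r a} → Choice r a → Choice r a → Set
T ⊑ T′ = ∀ i → ∃ λ j → chosen T i ≡ chosen T′ j

-- A `Choice` is a canonical form of its set: the set contains `zero` exactly when the scan begins
-- with `pick`, and so on along the scan.
⊑-antisym : ∀ {r a} {T T′ : Choice r a} → T ⊑ T′ → T′ ⊑ T → T ≡ T′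
⊑-antisym {T = stop}   {stop}    _  _  = refl
⊑-antisym {T = pick T} {pick T′} le ge = cong pick (⊑-antisym (tails le) (tails ge))
  where
  tails : ∀ {r a} {T T′ : Choice r a} → pick T ⊑ pick T′ → T ⊑ T′
  tails le i with le (suc i)
  ... | suc j , eq = j , Fin.suc-injective eq
⊑-antisym {T = pick T} {skip T′} le ge with le zero
... | _ , ()
⊑-antisym {T = skip T} {pick T′} le ge with ge zero
... | _ , ()
⊑-antisym {T = skip T} {skip T′} le ge = cong skip (⊑-antisym (tails le) (tails ge))
  where
  tails : ∀ {r a} {T T′ : Choice (suc r) a} → skip T ⊑ skip T′ → T ⊑ T′
  tails le i with le i
  ... | j , eq = j , Fin.suc-injective eq

choices : ∀ r a → List (Choice r a)
choices zero    a       = [ stop ]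
choices (suc r) zero    = []
choices (suc r) (suc a) = map pick (choices r a) ++ map skip (choices (suc r) a)

length-choices : ∀ r a → length (choices r a) ≡ a C r
length-choices zero    a       = refl
length-choices (suc r) zero    = refl
length-choices (suc r) (suc a) = begin
  length (map pick (choices r a) ++ map skip (choices (suc r) a))          ≡⟨ length-++ (map pick (choices r a)) ⟩
  length (map pick (choices r a)) + length (map skip (choices (suc r) a))  ≡⟨ cong₂ _+_ (length-map pick (choices r a)) (length-map skip (choices (suc r) a)) ⟩
  length (choices r a) + length (choices (suc r) a)                        ≡⟨ cong₂ _+_ (length-choices r a) (length-choices (suc r) a) ⟩
  a C r + a C suc r                                                        ≡⟨ nCk+nC[k+1]≡[n+1]C[k+1] a r ⟩
  suc a C suc r                                                            ∎
  where open ≡-Reasoning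

choices-unique : ∀ r a → Unique (choices r a)
choices-unique zero    a       = [] ∷ []
choices-unique (suc r) zero    = []
choices-unique (suc r) (suc a) = Unique.++⁺
  (Unique.map⁺ (λ { refl → refl }) (choices-unique r a))
  (Unique.map⁺ (λ { refl → refl }) (choices-unique (suc r) a))
  λ { (p , q) → disjoint (∈-map⁻ pick p) (∈-map⁻ skip q) }
  where
  disjoint : ∀ {T} → (∃ λ T₁ → _ × T ≡ pick T₁) → (∃ λ T₂ → _ × T ≡ skip T₂) → Empty.⊥
  disjoint (_ , _ , refl) (_ , _ , ())

-- Takes the place of function extensionality when a coded function is recovered from its values.
funToFin-cong : ∀ {m n} {f g : Fin m → Fin n} → f ≗ g → funToFin f ≡ funToFin g
funToFin-cong {zero}  f≗g = refl
funToFin-cong {suc m} f≗g = cong₂ combine (f≗g zero) (funToFin-cong (f≗g ∘ suc))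

finToFun-injective : ∀ {m n} (i j : Fin (n ^ m)) → finToFun {n} {m} i ≗ finToFun j → i ≡ j
finToFun-injective {m} {n} i j eq =
  trans (sym (funToFin-finToFin {m} {n} i)) (trans (funToFin-cong eq) (funToFin-finToFin {m} {n} j))

length-cartesianProductWith : ∀ {A B C : Set} (f : A → B → C) xs ys →
  length (cartesianProductWith f xs ys) ≡ length xs * length ys
length-cartesianProductWith f []       ys = refl
length-cartesianProductWith f (x ∷ xs) ys = trans (length-++ (map (f x) ys))
  (cong₂ _+_ (length-map (f x) ys) (length-cartesianProductWith f xs ys))

-- The construction

-- Fin n splits as the core Fin r, the apexes Fin (a ^ r) and the a blocks of b sites.  Every map
-- Fin r → Fin a gets an apex, although only the increasing ones, the Choices, are used.
module Construction (r′ a b : ℕ) where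

  r q n : ℕ
  r = suc r′
  q = a ^ r + a * b
  n = r + q

  core : Fin r → Fin n
  core i = i ↑ˡ q

  outer : Fin q → Fin n
  outer j = r ↑ʳ j

  apex : Choice r a → Fin n
  apex T = outer (funToFin (chosen T) ↑ˡ (a * b))

  site : Fin a → Fin b → Fin n
  site s t = outer (a ^ r ↑ʳ combine s t)

  view : ∀ v → (∃ λ i → v ≡ core i) ⊎ (∃ λ j → v ≡ outer j)
  view v with splitAt r v in eq
  ... | inj₁ i = inj₁ (i , sym (splitAt⁻¹-↑ˡ eq))
  ... | inj₂ j = inj₂ (j , sym (splitAt⁻¹-↑ʳ eq))

  outer≢core : ∀ {i j} → outer j ≢ core i
  outer≢core {i} {j} eq with trans (sym (splitAt-↑ʳ r q j)) (trans (cong (splitAt r) eq) (splitAt-↑ˡ r i q))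
  ... | ()

  outer-injective : ∀ {i j} → outer i ≡ outer j → i ≡ j
  outer-injective = ↑ʳ-injective r _ _

  apex-injective : ∀ {T T′} → apex T ≡ apex T′ → T ≡ T′
  apex-injective {T} {T′} eq = ⊑-antisym (λ i → i , same i) (λ i → i , sym (same i))
    where
    same : chosen T ≗ chosen T′
    same i = trans (sym (finToFun-funToFin (chosen T) i))
      (trans (cong (λ c → finToFun c i) (↑ˡ-injective (a * b) _ _ (outer-injective eq)))
        (finToFun-funToFin (chosen T′) i))

  site-injective : ∀ {s s′ t t′} → site s t ≡ site s′ t′ → s ≡ s′ × t ≡ t′
  site-injective {s} {s′} {t} {t′} eq =
    combine-injective s t s′ t′ (↑ʳ-injective (a ^ r) _ _ (outer-injective eq))

  -- The core and the apexes get `nothing`, so this value also tells the apex of a cone from its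
  -- sites.
  block : Fin n → Maybe (Fin a)
  block v = [ const nothing , [ const nothing , just ∘ proj₁ ∘ remQuot {a} b ]′ ∘ splitAt (a ^ r) ]′ (splitAt r v)

  block-apex : ∀ T → block (apex T) ≡ nothing
  block-apex T
    rewrite splitAt-↑ʳ r q (funToFin (chosen T) ↑ˡ (a * b))
          | splitAt-↑ˡ (a ^ r) (funToFin (chosen T)) (a * b) = refl

  block-site : ∀ s t → block (site s t) ≡ just s
  block-site s t
    rewrite splitAt-↑ʳ r q (a ^ r ↑ʳ combine s t)
          | splitAt-↑ʳ (a ^ r) (a * b) (combine s t) = cong (just ∘ proj₁) (remQuot-combine s t)

  apex≢site : ∀ {T s t} → apex T ≢ site s t
  apex≢site {T} {s} {t} eq with trans (sym (block-apex T)) (trans (cong block eq) (block-site s t))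
  ... | ()

  -- Stars and cones as consecutive edges

  -- Stars and cones are described by membership alone, so that only the vertex set of a window
  -- matters and not its order.
  record Star (xs : List (Fin n)) : Set where
    field
      tip   : Fin q
      ∈⇒    : ∀ {v} → v ∈ xs → (∃ λ i → v ≡ core i) ⊎ v ≡ outer tip
      core∈ : ∀ i → core i ∈ xs

  record Cone (xs : List (Fin n)) : Set where
    field
      base  : Choice r a
      point : Fin r → Fin b
      ∈⇒    : ∀ {v} → v ∈ xs → v ≡ apex base ⊎ (∃ λ i → v ≡ site (chosen base i) (point i))
      apex∈ : apex base ∈ xs
      site∈ : ∀ i → site (chosen base i) (point i) ∈ xs

  cone-outer : ∀ {xs v} → Cone xs → v ∈ xs → ∃ λ j → v ≡ outer j
  cone-outer K v∈ with Cone.∈⇒ K v∈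
  ... | inj₁ v≡       = _ , v≡
  ... | inj₂ (_ , v≡) = _ , v≡

  star-outer : ∀ {xs j} (S : Star xs) → outer j ∈ xs → outer j ≡ outer (Star.tip S)
  star-outer S j∈ with Star.∈⇒ S j∈
  ... | inj₁ (i , eq) = contradiction eq outer≢core
  ... | inj₂ eq       = eq

  -- A cone has one site in each of its blocks, and its apex is its only vertex without a block.
  cone-block-injective : ∀ {xs u v} → Cone xs → u ∈ xs → v ∈ xs → block u ≡ block v → u ≡ v
  cone-block-injective K u∈ v∈ eq with Cone.∈⇒ K u∈ | Cone.∈⇒ K v∈
  ... | inj₁ refl       | inj₁ refl       = refl
  ... | inj₁ refl       | inj₂ (j , refl)
    with trans (sym (block-apex (Cone.base K))) (trans eq (block-site _ _))
  ... | ()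
  cone-block-injective K u∈ v∈ eq | inj₂ (i , refl) | inj₁ refl
    with trans (sym (block-apex (Cone.base K))) (trans (sym eq) (block-site _ _))
  ... | ()
  cone-block-injective K u∈ v∈ eq | inj₂ (i , refl) | inj₂ (j , refl)
    with chosen-injective (Cone.base K) (just-injective
           (trans (sym (block-site _ _)) (trans eq (block-site _ _))))
  ... | refl = refl

  -- A core vertex belongs to every star, so it would have to recur in `M`, against uniqueness, or
  -- as `v`, which makes the two edges equal.
  star-head : ∀ {u v M} → Star (u ∷ M) → Star (M ∷ʳ v) → Unique (u ∷ M) →
    toSubset (u ∷ M) ≢ toSubset (M ∷ʳ v) → ∃ λ j → u ≡ outer j
  star-head {u} {v} {M} S S′ uniq different with view u
  ... | inj₂ outer-u = outer-u
  ... | inj₁ (i , refl) with ∈-++⁻ M (Star.core∈ S′ i)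
  ...   | inj₁ u∈M         = contradiction u∈M (Unique[x∷xs]⇒x∉xs uniq)
  ...   | inj₂ (here refl) = contradiction (toSubset-rotate u M) different

  -- Two distinct shared vertices would both lie outside the core, as they belong to a cone, but a
  -- star has only one such vertex.
  star-cone-disjoint : ∀ {xs ys M} → 2 ≤ r → Star xs → Cone ys → (∀ {v} → v ∈ M → v ∈ xs) →
    (∀ {v} → v ∈ M → v ∈ ys) → Unique M → length M ≢ r
  star-cone-disjoint {M = []}        _ S K M⊆xs M⊆ys uniq ()
  star-cone-disjoint {M = u ∷ []}    (s≤s ()) S K M⊆xs M⊆ys uniq refl
  star-cone-disjoint {M = u ∷ v ∷ M} _ S K M⊆xs M⊆ys ((u≢v ∷ _) ∷ _) _
    with cone-outer K (M⊆ys (here refl)) | cone-outer K (M⊆ys (there (here refl)))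
  ... | _ , refl | _ , refl = u≢v (trans (star-outer S (M⊆xs (here refl)))
                                    (sym (star-outer S (M⊆xs (there (here refl))))))

  module ConeStep {u v M} (K : Cone (u ∷ M)) (K′ : Cone (M ∷ʳ v)) (uniq : Unique (u ∷ M))
                  (different : toSubset (u ∷ M) ≢ toSubset (M ∷ʳ v)) where
    open Cone

    u∉M : u ∉ M
    u∉M = Unique[x∷xs]⇒x∉xs uniq

    -- If `u` were an apex, it would be that of `K`, and `M` would consist of the sites of `K`. Then
    -- the apex of `K′` must be `v`, both cones have the same base, and so `u` and `v` coincide.
    head≢apex : ∀ {T} → u ≢ apex T
    head≢apex {T} refl with ∈⇒ K (here refl)
    ... | inj₂ (_ , eq) = apex≢site eq
    ... | inj₁ apexT≡ with ∈-++⁻ M (apex∈ K′)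
    ...   | inj₁ apex∈M = u∉M (subst (_∈ M) (cone-block-injective K (there apex∈M) (here refl)
                            (trans (block-apex (base K′)) (sym (block-apex T)))) apex∈M)
    ...   | inj₂ (here apex≡v) = different (trans (cong (λ w → toSubset (w ∷ M)) u≡v) (toSubset-rotate v M))
      where
      -- As `u` and `v` are both apexes, the sites of either cone all lie in `M` and hence in the
      -- other cone.
      ⊑₁ : base K ⊑ base K′
      ⊑₁ i with site∈ K i
      ... | here eq = contradiction (sym eq) apex≢site
      ... | there site∈M with ∈⇒ K′ (∈-++⁺ˡ site∈M)
      ...   | inj₁ eq       = contradiction (sym eq) apex≢site
      ...   | inj₂ (j , eq) = j , proj₁ (site-injective eq)
      ⊑₂ : base K′ ⊑ base K
      ⊑₂ i with ∈-++⁻ M (site∈ K′ i)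
      ... | inj₂ (here eq) = contradiction (trans apex≡v (sym eq)) apex≢site
      ... | inj₁ site∈M with ∈⇒ K (there site∈M)
      ...   | inj₁ eq       = contradiction (sym eq) apex≢site
      ...   | inj₂ (j , eq) = j , proj₁ (site-injective eq)
      u≡v : apex T ≡ v
      u≡v = trans apexT≡ (trans (cong apex (⊑-antisym ⊑₁ ⊑₂)) apex≡v)

    -- The apex of `K` survives in `M` and is also the apex of `K′`, so the bases agree. Thus `K′`
    -- has a site in the block of `u`; it cannot lie in `M`, because `K` meets that block only in
    -- `u`, so it is `v`.
    same-block : block u ≡ block v
    same-block with ∈⇒ K (here refl) | apex∈ K
    ... | inj₁ u≡apex     | _            = contradiction u≡apex head≢apex
    ... | inj₂ _          | here apex≡u  = contradiction (sym apex≡u) head≢apex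
    ... | inj₂ (i , u≡)   | there apex∈M with ∈⇒ K′ (∈-++⁺ˡ apex∈M)
    ...   | inj₂ (_ , eq) = contradiction eq apex≢site
    ...   | inj₁ eq with ∈-++⁻ M (subst (λ T → site (chosen T i) (point K′ i) ∈ M ∷ʳ v)
                                        (sym (apex-injective eq)) (site∈ K′ i))
    ...     | inj₁ site∈M = contradiction (subst (_∈ M) (cone-block-injective K (there site∈M) (here refl)
                              (trans (block-site _ _) (sym block-u))) site∈M) u∉M
      where
      block-u = trans (cong block u≡) (block-site _ _)
    ...     | inj₂ (here site≡v) = trans (trans (cong block u≡) (block-site _ _))
                                     (trans (sym (block-site _ _)) (cong block site≡v))

  -- Excluding closed tours

  -- The bound is carried along with a cone because for r = 1 a single shared vertex would not keep
  -- stars and cones apart.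
  Edge : List (Fin n) → Set
  Edge xs = Star xs ⊎ (2 ≤ r × Cone xs)

  open Tour

  next-edge : ∀ {vs} → Tour Edge r vs → ∀ P u M v Q → vs ≡ P ++ u ∷ M ++ v ∷ Q →
    length M ≡ r → Edge (M ∷ʳ v)
  next-edge t P u M v Q eq len = proj₁ (edge t (P ∷ʳ u) (M ∷ʳ v) Q
    (shift-window P u M v Q eq)
    (trans (length-∷ʳ M v) (cong suc len)))

  this-unique : ∀ {vs} → Tour Edge r vs → ∀ P u M v Q → vs ≡ P ++ u ∷ M ++ v ∷ Q →
    length M ≡ r → Unique (u ∷ M)
  this-unique t P u M v Q eq len = proj₂ (edge t P (u ∷ M) (v ∷ Q) eq (cong suc len))

  next-star : ∀ {vs} → Tour Edge r vs → ∀ P u M v Q → vs ≡ P ++ u ∷ M ++ v ∷ Q →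
    length M ≡ r → Star (u ∷ M) → Star (M ∷ʳ v)
  next-star t P u M v Q eq len S with next-edge t P u M v Q eq len | this-unique t P u M v Q eq len
  ... | inj₁ S′         | _        = S′
  ... | inj₂ (2≤r , K′) | (_ ∷ un) = contradiction len (star-cone-disjoint 2≤r S K′ there ∈-++⁺ˡ un)

  next-cone : ∀ {vs} → Tour Edge r vs → ∀ P u M v Q → vs ≡ P ++ u ∷ M ++ v ∷ Q →
    length M ≡ r → 2 ≤ r → Cone (u ∷ M) → Cone (M ∷ʳ v)
  next-cone t P u M v Q eq len 2≤r K with next-edge t P u M v Q eq len | this-unique t P u M v Q eq len
  ... | inj₁ S′       | (_ ∷ un) = contradiction len (star-cone-disjoint 2≤r S′ K ∈-++⁺ˡ there un)
  ... | inj₂ (_ , K′) | _        = K′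

  -- The first three windows would all be stars. By `star-head` both `u` and `v` lie outside the
  -- core, yet they share a star.
  ¬star-first : ∀ {u v M c d Q} → Tour Edge r (u ∷ v ∷ M ++ c ∷ d ∷ Q) → length M ≡ r′ →
    ¬ Star (u ∷ v ∷ M)
  ¬star-first {u} {v} {M} {c} {d} {Q} t len S = Unique[x∷xs]⇒x∉xs uniq (here u≡v)
    where
    uniq  = this-unique t [] u (v ∷ M) c (d ∷ Q) refl (cong suc len)
    S₁    = next-star t [] u (v ∷ M) c (d ∷ Q) refl (cong suc len) S
    eq    = shift-window [] u (v ∷ M) c (d ∷ Q) refl
    len₁  = trans (length-∷ʳ M c) (cong suc len)
    S₂    = next-star t [ u ] v (M ∷ʳ c) d Q eq len₁ S₁
    outer-u = star-head S S₁ uniq (distinct t [] u (v ∷ M) c (d ∷ Q) refl (cong suc len))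
    outer-v = star-head S₁ S₂ (this-unique t [ u ] v (M ∷ʳ c) d Q eq len₁)
                (distinct t [ u ] v (M ∷ʳ c) d Q eq len₁)
    u≡v : u ≡ v
    u≡v with outer-u | outer-v
    ... | _ , refl | _ , refl = trans (star-outer S (here refl)) (sym (star-outer S (there (here refl))))

  -- Induction on the prefix: `next-cone` carries the shape from the first window to the second,
  -- which is the first window of the tail.
  all-cones : ∀ {vs} → Tour Edge r vs → 2 ≤ r →
    (∀ M Q → vs ≡ M ++ Q → length M ≡ suc r → Cone M) →
    ∀ P M Q → vs ≡ P ++ M ++ Q → length M ≡ suc r → Cone M
  all-cones t 2≤r first []      M Q eq   len = first M Q eq len
  all-cones t 2≤r first (p ∷ P) M Q refl len = all-cones (tour-tail t) 2≤r first′ P M Q refl len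
    where
    first′ : ∀ N R → P ++ M ++ Q ≡ N ++ R → length N ≡ suc r → Cone N
    first′ N R eq len-N with initLast N
    ... | N′ ∷ʳ′ x = next-cone t [] p N′ x R eq′ len′ 2≤r (first (p ∷ N′) (x ∷ R) eq′ (cong suc len′))
      where
      len′ : length N′ ≡ r
      len′ = suc-injective (trans (sym (length-∷ʳ N′ x)) len-N)
      eq′ : p ∷ P ++ M ++ Q ≡ p ∷ N′ ++ x ∷ R
      eq′ = cong (p ∷_) (trans eq (∷ʳ-++ N′ x R))

  -- Length r + 3 leaves room for three windows, so `¬star-first` rules out a star.
  first-cone : ∀ {vs} → Tour Edge r vs → suc (suc (suc r)) ≤ length vs →
    ∀ M Q → vs ≡ M ++ Q → length M ≡ suc r → 2 ≤ r × Cone M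
  first-cone {vs} t long M Q eq len with proj₁ (edge t [] M Q eq len)
  ... | inj₂ K = K
  ... | inj₁ S = contradiction S (¬star M Q eq len 2≤|Q|)
    where
    2≤|Q| : 2 ≤ length Q
    2≤|Q| = +-cancelˡ-≤ (suc r) 2 (length Q) (begin
      suc r + 2           ≡⟨ +-comm (suc r) 2 ⟩
      suc (suc (suc r))   ≤⟨ long ⟩
      length vs           ≡⟨ cong length eq ⟩
      length (M ++ Q)     ≡⟨ length-++ M ⟩
      length M + length Q ≡⟨ cong (_+ length Q) len ⟩
      suc r + length Q    ∎)
      where open ≤-Reasoning
    ¬star : ∀ M Q → vs ≡ M ++ Q → length M ≡ suc r → 2 ≤ length Q → ¬ Star M
    ¬star (u ∷ v ∷ M) (c ∷ d ∷ Q) refl len _ = ¬star-first t (suc-injective (suc-injective len))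
    ¬star (u ∷ v ∷ M) (c ∷ []) _ _ (s≤s ())

  cone-step : ∀ {vs} → Tour Edge r vs → (∀ P M Q → vs ≡ P ++ M ++ Q → length M ≡ suc r → Cone M) →
    ∀ P u M v Q → vs ≡ P ++ u ∷ M ++ v ∷ Q → length M ≡ r →
    (∀ {T} → u ≢ apex T) × block u ≡ block v
  cone-step t cones P u M v Q eq len = head≢apex , same-block
    where
    open ConeStep
      (cones P (u ∷ M) (v ∷ Q) eq (cong suc len))
      (cones (P ∷ʳ u) (M ∷ʳ v) Q
        (shift-window P u M v Q eq)
        (trans (length-∷ʳ M v) (cong suc len)))
      (this-unique t P u M v Q eq len)
      (distinct t P u M v Q eq len)

  ¬closed-tour : ∀ {v P a M} → length M ≡ r → ¬ Tour Edge r (v ∷ P ++ a ∷ M ++ [ v ])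
  ¬closed-tour {v} {P} {a} {M} len t = [ short , long ]′ (<-≤-connex (length P) r)
    where
    vs = v ∷ P ++ a ∷ M ++ [ v ]
    |R| : length (M ++ [ v ]) ≡ suc r
    |R| = trans (length-∷ʳ M v) (cong suc len)
    -- Counted are `v`, `a`, the r entries of `M` and the closing `v`.
    long-vs : suc (suc (suc r)) ≤ length vs
    long-vs = s≤s (begin
      suc (suc r)                        ≡⟨ cong suc |R| ⟨
      length (a ∷ M ++ [ v ])            ≤⟨ m≤n+m _ (length P) ⟩
      length P + length (a ∷ M ++ [ v ]) ≡⟨ length-++ P ⟨
      length (P ++ a ∷ M ++ [ v ])       ∎)
      where open ≤-Reasoning
    2≤r : 2 ≤ r
    2≤r = let M₀ , Q₀ , eq , len₀ = split (suc r) vs (≤-trans (≤-trans (n≤1+n _) (n≤1+n _)) long-vs)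
          in proj₁ (first-cone t long-vs M₀ Q₀ eq len₀)
    cones : ∀ P M Q → vs ≡ P ++ M ++ Q → length M ≡ suc r → Cone M
    cones = all-cones t 2≤r (λ M Q eq len → proj₂ (first-cone t long-vs M Q eq len))
    step = cone-step t cones
    -- The last step of the tour drops `a` and adds the closing `v`.
    block-a≡block-v : block a ≡ block v
    block-a≡block-v = proj₂ (step (v ∷ P) a M v [] refl len)
    -- Here `a` already lies in the first window, next to the initial `v`. That window is a cone, so
    -- sharing a block makes `a` and `v` equal, and the window repeats a vertex.
    short : length P < r → Empty.⊥
    short |P|<r with split (r ∸ suc (length P)) (M ++ [ v ])
                       (≤-trans (m∸n≤m r (suc (length P))) (≤-trans (n≤1+n r) (≤-reflexive (sym |R|))))
    ... | R , Q , eq , |R|≡ = Unique[x∷xs]⇒x∉xs (proj₂ (edge t [] W Q eq′ |W|))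
            (subst (_∈ P ++ a ∷ R) a≡v a∈)
      where
      W = v ∷ P ++ a ∷ R
      a∈ : a ∈ P ++ a ∷ R
      a∈ = ∈-++⁺ʳ P (here refl)
      eq′ : vs ≡ W ++ Q
      eq′ = cong (v ∷_) (trans (cong (λ xs → P ++ a ∷ xs) eq) (sym (++-assoc P (a ∷ R) Q)))
      |W| : length W ≡ suc r
      |W| = cong suc (begin
        length (P ++ a ∷ R)                        ≡⟨ length-++ P ⟩
        length P + suc (length R)                  ≡⟨ +-suc (length P) (length R) ⟩
        suc (length P) + length R                  ≡⟨ cong (suc (length P) +_) |R|≡ ⟩
        suc (length P) + (r ∸ suc (length P))      ≡⟨ m+[n∸m]≡n |P|<r ⟩
        r                                          ∎)
        where open ≡-Reasoning
      a≡v : a ≡ v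
      a≡v = cone-block-injective (cones [] W Q eq′ |W|) (there a∈) (here refl) block-a≡block-v
    -- Here the first window `v ∷ N` ends before `a`, so at least r + 1 vertices follow its apex.
    -- The window that starts at this apex therefore has a successor, and passing to it drops the
    -- apex.
    long : r ≤ length P → Empty.⊥
    long r≤|P| with split r P r≤|P|
    ... | N , P′ , refl , |N| with cones [] (v ∷ N) (P′ ++ a ∷ M ++ [ v ]) (cong (v ∷_) (++-assoc N P′ _)) (cong suc |N|)
    ...   | K with ∈-∃++ (Cone.apex∈ K)
    ...     | L , L′ , eq with splitAround r (L′ ++ P′ ++ a ∷ M ++ [ v ]) (begin
        suc r                                         ≡⟨ |R| ⟨
        length (M ++ [ v ])                           ≤⟨ n≤1+n _ ⟩
        length (a ∷ M ++ [ v ])                       ≤⟨ m≤n+m _ (length P′) ⟩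
        length P′ + length (a ∷ M ++ [ v ])           ≡⟨ length-++ P′ ⟨
        length (P′ ++ a ∷ M ++ [ v ])                 ≤⟨ m≤n+m _ (length L′) ⟩
        length L′ + length (P′ ++ a ∷ M ++ [ v ])     ≡⟨ length-++ L′ ⟨
        length (L′ ++ P′ ++ a ∷ M ++ [ v ])           ∎)
      where open ≤-Reasoning
    ...       | M′ , w , Q′ , eq′ , |M′| = proj₁ (step L (apex (Cone.base K)) M′ w Q′ vs≡ |M′|) refl
      where
      vs≡ : v ∷ (N ++ P′) ++ a ∷ M ++ [ v ] ≡ L ++ apex (Cone.base K) ∷ M′ ++ w ∷ Q′
      vs≡ = begin
        v ∷ (N ++ P′) ++ a ∷ M ++ [ v ]                              ≡⟨ cong (v ∷_) (++-assoc N P′ _) ⟩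
        (v ∷ N) ++ P′ ++ a ∷ M ++ [ v ]                              ≡⟨ cong (_++ P′ ++ a ∷ M ++ [ v ]) eq ⟩
        (L ++ apex (Cone.base K) ∷ L′) ++ P′ ++ a ∷ M ++ [ v ]       ≡⟨ ++-assoc L _ _ ⟩
        L ++ apex (Cone.base K) ∷ L′ ++ P′ ++ a ∷ M ++ [ v ]         ≡⟨ cong (λ xs → L ++ apex (Cone.base K) ∷ xs) eq′ ⟩
        L ++ apex (Cone.base K) ∷ M′ ++ w ∷ Q′                       ∎
        where open ≡-Reasoning

  -- The edges as vertex lists

  cores : List (Fin n)
  cores = tabulate core

  length-cores : length cores ≡ r
  length-cores = length-tabulate core

  cores-unique : Unique cores
  cores-unique = Unique.tabulate⁺ {f = core} (↑ˡ-injective q _ _)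

  core∈cores : ∀ i → core i ∈ cores
  core∈cores = ∈-tabulate⁺ {f = core}

  ∈-cores⁻ : ∀ {v} → v ∈ cores → ∃ λ i → v ≡ core i
  ∈-cores⁻ = ∈-tabulate⁻ {f = core}

  outer∉cores : ∀ {j} → outer j ∉ cores
  outer∉cores j∈ with ∈-cores⁻ j∈
  ... | _ , eq = outer≢core eq

  starList : Fin q → List (Fin n)
  starList j = outer j ∷ cores

  -- The number `w` codes one site in each chosen block, so that `allFin (b ^ r)` runs through all
  -- such selections.
  baseSite : Choice r a → Fin (b ^ r) → Fin r → Fin n
  baseSite T w i = site (chosen T i) (finToFun w i)

  coneList : Choice r a → Fin (b ^ r) → List (Fin n)
  coneList T w = apex T ∷ tabulate (baseSite T w)

  starList-star : ∀ j → Star (starList j)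
  starList-star j = record { tip = j ; ∈⇒ = bound ; core∈ = λ i → there (core∈cores i) }
    where
    bound : ∀ {v} → v ∈ starList j → (∃ λ i → v ≡ core i) ⊎ v ≡ outer j
    bound (here eq)  = inj₂ eq
    bound (there v∈) = inj₁ (∈-cores⁻ v∈)

  coneList-cone : ∀ T w → Cone (coneList T w)
  coneList-cone T w = record
    { base = T ; point = finToFun w ; ∈⇒ = bound ; apex∈ = here refl ; site∈ = λ i → there (∈-tabulate⁺ {f = baseSite T w} i) }
    where
    bound : ∀ {v} → v ∈ coneList T w → v ≡ apex T ⊎ (∃ λ i → v ≡ baseSite T w i)
    bound (here eq)  = inj₁ eq
    bound (there v∈) = inj₂ (∈-tabulate⁻ {f = baseSite T w} v∈)

  starList-unique : ∀ j → Unique (starList j)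
  starList-unique j = ∉⇒All≢ outer∉cores ∷ cores-unique

  coneList-unique : ∀ T w → Unique (coneList T w)
  coneList-unique T w = ∉⇒All≢ (λ apex∈ → apex≢site (proj₂ (∈-tabulate⁻ {f = baseSite T w} apex∈)))
    ∷ Unique.tabulate⁺ {f = baseSite T w} (λ {i} {j} eq → chosen-injective T
        (proj₁ (site-injective {t = finToFun w i} {finToFun w j} eq)))

  -- Transfers the shape from the standard listing of an edge to the order in which a tour lists it.
  star-resp : ∀ {xs ys} → toSubset xs ≡ toSubset ys → Star ys → Star xs
  star-resp eq S = record
    { tip = Star.tip S ; ∈⇒ = Star.∈⇒ S ∘ toSubset-⊆ eq ; core∈ = toSubset-⊆ (sym eq) ∘ Star.core∈ S }

  cone-resp : ∀ {xs ys} → toSubset xs ≡ toSubset ys → Cone ys → Cone xs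
  cone-resp eq K = record
    { base = Cone.base K ; point = Cone.point K ; ∈⇒ = Cone.∈⇒ K ∘ toSubset-⊆ eq
    ; apex∈ = toSubset-⊆ (sym eq) (Cone.apex∈ K) ; site∈ = toSubset-⊆ (sym eq) ∘ Cone.site∈ K }

  starEdge : Fin q → Subset n
  starEdge = toSubset ∘ starList

  coneEdge : Choice r a → Fin (b ^ r) → Subset n
  coneEdge T w = toSubset (coneList T w)

  starEdge-injective : ∀ {i j} → starEdge i ≡ starEdge j → i ≡ j
  starEdge-injective {i} {j} eq = outer-injective (star-outer (starList-star j) (toSubset-⊆ {xs = starList i} eq (here refl)))

  -- The apex determines `T`; after that, the site in each chosen block determines the value of `w`
  -- there.
  coneEdge-injective : ∀ {T T′ w w′} → coneEdge T w ≡ coneEdge T′ w′ → T ≡ T′ × w ≡ w′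
  coneEdge-injective {T} {T′} {w} {w′} eq with Cone.∈⇒ (coneList-cone T′ w′) (toSubset-⊆ {xs = coneList T w} eq (here refl))
  ... | inj₂ (_ , apex≡) = contradiction apex≡ apex≢site
  ... | inj₁ apex≡ with apex-injective {T} {T′} apex≡
  ... | refl = refl , finToFun-injective {r} {b} w w′ same
    where
    same : finToFun {b} {r} w ≗ finToFun w′
    same i with Cone.∈⇒ (coneList-cone T w′) (toSubset-⊆ {xs = coneList T w} eq (Cone.site∈ (coneList-cone T w) i))
    ... | inj₁ site≡       = contradiction (sym site≡) apex≢site
    ... | inj₂ (j , site≡) with site-injective site≡
    ... | s≡ , t≡ with chosen-injective T s≡
    ... | refl = t≡

  starEdge≢coneEdge : ∀ {j T w} → starEdge j ≢ coneEdge T w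
  starEdge≢coneEdge {j} {T} {w} eq
    with cone-outer (coneList-cone T w) (toSubset-⊆ {xs = starList j} eq (Star.core∈ (starList-star j) zero))
  ... | _ , core≡outer = outer≢core (sym core≡outer)

  -- The hypergraph and its hypertree property

  -- `Ts` lists the block sets that carry cones; by `Ts-size` it is empty when r = 1. The outer
  -- vertex `o` completes the core to a star, which serves as the chain through two core vertices.
  module Graph (Ts : List (Choice r a)) (Ts-unique : Unique Ts) (Ts-size : ∀ {T} → T ∈ Ts → 2 ≤ r)
               (o : Fin q) where

    stars cones : List (Subset n)
    stars = map starEdge (allFin q)
    cones = cartesianProductWith coneEdge Ts (allFin (b ^ r))

    graph : Hypergraph (suc r) n
    graph = record
      { edges        = stars ++ cones
      ; edges-unique = Unique.++⁺ (Unique.map⁺ starEdge-injective (Unique.allFin⁺ q))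
          (Unique.cartesianProductWith⁺ coneEdge coneEdge-injective Ts-unique (Unique.allFin⁺ (b ^ r)))
          λ (s∈ , c∈) → let _ , _ , s≡ = ∈-map⁻ starEdge s∈
                            _ , _ , _ , _ , c≡ = ∈-cartesianProductWith⁻ coneEdge Ts (allFin (b ^ r)) c∈
                        in starEdge≢coneEdge (trans (sym s≡) c≡)
      ; edges-size   = All.++⁺
          (All.map⁺ (All.tabulate λ {j} _ → trans (∣toSubset∣ (starList-unique j)) (cong suc length-cores)))
          (All.cartesianProductWith⁺ (setoid _) (setoid _) coneEdge Ts (allFin (b ^ r)) λ {T} {w} _ _ →
            trans (∣toSubset∣ (coneList-unique T w)) (cong suc (length-tabulate (baseSite T w))))
      }

    length-edges : length (edges graph) ≡ q + length Ts * b ^ r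
    length-edges = trans (length-++ stars) (cong₂ _+_
      (trans (length-map starEdge (allFin q)) (length-tabulate id))
      (trans (length-cartesianProductWith coneEdge Ts (allFin (b ^ r))) (cong (length Ts *_) (length-tabulate {n = b ^ r} id))))

    edge⇒ : ∀ {xs} → toSubset xs ∈ edges graph → Edge xs
    edge⇒ xs∈ with ∈-++⁻ stars xs∈
    ... | inj₁ s∈ with ∈-map⁻ starEdge s∈
    ...   | j , _ , eq = inj₁ (star-resp eq (starList-star j))
    edge⇒ xs∈ | inj₂ c∈ with ∈-cartesianProductWith⁻ coneEdge Ts (allFin (b ^ r)) c∈
    ...   | T , w , T∈ , _ , eq = inj₂ (Ts-size T∈ , cone-resp eq (coneList-cone T w))

    starEdge∈ : ∀ j → starEdge j ∈ edges graph
    starEdge∈ j = ∈-++⁺ˡ (∈-map⁺ starEdge (∈-allFin j))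

    starEdge∈′ : ∀ j → toSubset (cores ∷ʳ outer j) ∈ edges graph
    starEdge∈′ j = subst (_∈ edges graph) (toSubset-rotate (outer j) cores) (starEdge∈ j)

    semicycleFree : SemicycleFree graph
    semicycleFree vs (ws , closed) with closedTour (windowSeq⇒tour graph ws) (proj₁ ws) closed
    ... | v , P , a , M , refl , len = ¬closed-tour len
      (record { edge = λ P M Q eq l → let e , u = edge t P M Q eq l in edge⇒ e , u ; distinct = distinct t })
      where
      t = windowSeq⇒tour graph ws

    -- With the tip placed last, the sequence starts in the core and ends outside it, so it is not
    -- closed.
    singleEdgeChain : ∀ j → IsChainSeq graph (cores ∷ʳ outer j)
    singleEdgeChain j =
      ( ≤-reflexive (sym len)
      , subst Unique (sym windows≡) ([] ∷ [])
      , subst (All (_∈ edges graph)) (sym windows≡) (starEdge∈′ j ∷ []))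
      , λ closed → outer≢core (sym (just-injective (trans closed (last-∷ʳ cores (outer j)))))
      where
      len : length (cores ∷ʳ outer j) ≡ suc r
      len = trans (length-∷ʳ cores (outer j)) (cong suc length-cores)
      windows≡ : windows (suc r) (cores ∷ʳ outer j) ≡ [ toSubset (cores ∷ʳ outer j) ]
      windows≡ = windows-single (cores ∷ʳ outer j) len

    doubleEdgeChain : ∀ i j → i ≢ j → IsChainSeq graph (outer i ∷ cores ∷ʳ outer j)
    doubleEdgeChain i j i≢j =
      ( subst (suc r ≤_) (sym (cong suc len)) (n≤1+n (suc r))
      , subst Unique (sym windows≡) (((λ eq → i≢j (starEdge-injective
          (trans eq (sym (toSubset-rotate (outer j) cores))))) ∷ []) ∷ [] ∷ [])
      , subst (All (_∈ edges graph)) (sym windows≡) (starEdge∈ i ∷ starEdge∈′ j ∷ []))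
      , λ closed → i≢j (outer-injective (just-injective (trans closed (last-∷ʳ (outer i ∷ cores) (outer j)))))
      where
      len : length (cores ∷ʳ outer j) ≡ suc r
      len = trans (length-∷ʳ cores (outer j)) (cong suc length-cores)
      windows≡ = windows-pair (outer i) cores (outer j) length-cores

    chainConnected : ChainConnected graph
    chainConnected u v u≢v with view u | view v
    ... | inj₁ (i , refl) | inj₁ (j , refl) = _ , singleEdgeChain o , ∈-++⁺ˡ (core∈cores i) , ∈-++⁺ˡ (core∈cores j)
    ... | inj₁ (i , refl) | inj₂ (j , refl) = _ , singleEdgeChain j , ∈-++⁺ˡ (core∈cores i) , ∈-++⁺ʳ cores (here refl)
    ... | inj₂ (i , refl) | inj₁ (j , refl) = _ , singleEdgeChain i , ∈-++⁺ʳ cores (here refl) , ∈-++⁺ˡ (core∈cores j)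
    ... | inj₂ (i , refl) | inj₂ (j , refl) = _ , doubleEdgeChain i j (λ i≡j → u≢v (cong outer i≡j)) ,
                                              here refl , there (∈-++⁺ʳ cores (here refl))

    hypertree : IsHypertree graph
    hypertree = chainConnected , semicycleFree

-- Counting

falling : ℕ → ℕ → ℕ
falling n       zero    = 1
falling zero    (suc k) = 0
falling (suc n) (suc k) = suc n * falling n k

-- Pascal's rule multiplied by (k + 1)!.
falling-pascal : ∀ n k → falling n (suc k) + suc k * falling n k ≡ falling (suc n) (suc k)
falling-pascal zero zero = refl
falling-pascal zero (suc k) = *-zeroʳ (suc (suc k))
falling-pascal (suc n) zero = trans (cong (λ z → suc z + 1) (*-identityʳ n))
  (trans (+-comm (suc n) 1) (cong (λ z → suc (suc z)) (sym (*-identityʳ n))))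
falling-pascal (suc n) (suc k) = trans
  (solve 4 (λ n k x y → (con 1 :+ n) :* x :+ (con 2 :+ k) :* ((con 1 :+ n) :* y)
      := (con 1 :+ n) :* (x :+ (con 1 :+ k) :* y) :+ (con 1 :+ n) :* y) refl n k (falling n (suc k)) (falling n k))
  (trans (cong (λ z → suc n * z + suc n * falling n k) (falling-pascal n k))
    (+-comm (suc n * (suc n * falling n k)) (suc n * falling n k)))

k!*nCk≡falling : ∀ n k → k ! * (n C k) ≡ falling n k
k!*nCk≡falling n       zero    = refl
k!*nCk≡falling zero    (suc k) = *-zeroʳ (suc k !)
k!*nCk≡falling (suc n) (suc k) = begin
  suc k ! * (suc n C suc k)                     ≡⟨ cong (suc k ! *_) (nCk+nC[k+1]≡[n+1]C[k+1] n k) ⟨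
  suc k ! * (n C k + n C suc k)                 ≡⟨ *-distribˡ-+ (suc k !) (n C k) (n C suc k) ⟩
  suc k * k ! * (n C k) + suc k ! * (n C suc k) ≡⟨ cong₂ _+_ (trans (*-assoc (suc k) (k !) (n C k)) (cong (suc k *_) (k!*nCk≡falling n k))) (k!*nCk≡falling n (suc k)) ⟩
  suc k * falling n k + falling n (suc k)       ≡⟨ +-comm (suc k * falling n k) _ ⟩
  falling n (suc k) + suc k * falling n k       ≡⟨ falling-pascal n k ⟩
  falling (suc n) (suc k)                       ∎
  where open ≡-Reasoning

falling-monoˡ : ∀ k {m n} → m ≤ n → falling m k ≤ falling n k
falling-monoˡ zero    m≤n       = ≤-refl
falling-monoˡ (suc k) z≤n       = z≤n
falling-monoˡ (suc k) (s≤s m≤n) = *-mono-≤ (s≤s m≤n) (falling-monoˡ k m≤n)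

falling≤^ : ∀ n k → falling n k ≤ n ^ k
falling≤^ n       zero    = ≤-refl
falling≤^ zero    (suc k) = z≤n
falling≤^ (suc n) (suc k) = *-monoʳ-≤ (suc n)
  (≤-trans (falling≤^ n k) (^-monoˡ-≤ k (n≤1+n n)))

-- The k factors are s + k, ..., s + 1.
^≤falling : ∀ s k → s ^ k ≤ falling (s + k) k
^≤falling s zero    = ≤-refl
^≤falling s (suc k) rewrite +-suc s k =
  *-mono-≤ (≤-trans (m≤m+n s k) (n≤1+n _)) (^≤falling s k)

-- Factor by factor, (a - i) b ≤ a b - i for i ≤ a, because b ≥ 1.
falling-*-^ : ∀ a b k → 1 ≤ b → falling a k * b ^ k ≤ falling (a * b) k
falling-*-^ a       b       zero    1≤b = ≤-refl
falling-*-^ zero    b       (suc k) 1≤b = z≤n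
falling-*-^ (suc a) (suc b) (suc k) 1≤b = begin
  suc a * falling a k * (suc b * suc b ^ k)   ≡⟨ solve 4 (λ a x b y → (a :* x) :* (b :* y) := (a :* b) :* (x :* y)) refl (suc a) (falling a k) (suc b) (suc b ^ k) ⟩
  suc a * suc b * (falling a k * suc b ^ k)   ≤⟨ *-monoʳ-≤ (suc a * suc b) (falling-*-^ a (suc b) k 1≤b) ⟩
  suc a * suc b * falling (a * suc b) k       ≤⟨ *-monoʳ-≤ (suc a * suc b) (falling-monoˡ k (m≤n+m (a * suc b) b)) ⟩
  suc a * suc b * falling (b + a * suc b) k   ∎
  where open ≤-Reasoning

-- The left side counts the k-sets with at most one point in each of a blocks of size b. The proof
-- multiplies by k! and compares falling factorials.
C-*-^≤C : ∀ a b k n → 1 ≤ b → a * b ≤ n → (a C k) * b ^ k ≤ n C k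
C-*-^≤C a b k n 1≤b ab≤n = *-cancelˡ-≤ (k !) ⦃ k !≢0 ⦄ (begin
  k ! * ((a C k) * b ^ k) ≡⟨ *-assoc (k !) (a C k) (b ^ k) ⟨
  k ! * (a C k) * b ^ k   ≡⟨ cong (_* b ^ k) (k!*nCk≡falling a k) ⟩
  falling a k * b ^ k     ≤⟨ falling-*-^ a b k 1≤b ⟩
  falling (a * b) k       ≤⟨ falling-monoˡ k ab≤n ⟩
  falling n k             ≡⟨ k!*nCk≡falling n k ⟨
  k ! * (n C k)           ∎)
  where open ≤-Reasoning

-- (1 + d/s)^k ≤ 1 + c/s, cleared of denominators.
^-perturb : ∀ d k → ∃ λ c → ∀ s → 1 ≤ s → s * (s + d) ^ k ≤ s ^ k * (s + c)
^-perturb d zero = 0 , λ s _ → ≤-reflexive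
  (solve 1 (λ s → s :* con 1 := con 1 :* (s :+ con 0)) refl s)
-- The witness comes from (1 + c/s)(1 + d/s) ≤ 1 + (c + d + c d)/s, where s ≥ 1 absorbs one factor
-- of the denominator s².
^-perturb d (suc k) with c , h ← ^-perturb d k = c + d + c * d , λ s 1≤s → begin
  s * ((s + d) * (s + d) ^ k)               ≡⟨ solve 3 (λ s x y → s :* (x :* y) := (s :* y) :* x) refl s (s + d) ((s + d) ^ k) ⟩
  s * (s + d) ^ k * (s + d)                 ≤⟨ *-monoˡ-≤ (s + d) (h s 1≤s) ⟩
  s ^ k * (s + c) * (s + d)                 ≡⟨ solve 4 (λ s x c d → (x :* (s :+ c)) :* (s :+ d) := x :* (s :* (s :+ (c :+ d)) :+ con 1 :* (c :* d))) refl s (s ^ k) c d ⟩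
  s ^ k * (s * (s + (c + d)) + 1 * (c * d)) ≤⟨ *-monoʳ-≤ (s ^ k) (+-monoʳ-≤ (s * (s + (c + d))) (*-monoˡ-≤ (c * d) 1≤s)) ⟩
  s ^ k * (s * (s + (c + d)) + s * (c * d)) ≡⟨ solve 4 (λ s x c d → x :* (s :* (s :+ (c :+ d)) :+ s :* (c :* d)) := (s :* x) :* (s :+ (c :+ d :+ c :* d))) refl s (s ^ k) c d ⟩
  s * s ^ k * (s + (c + d + c * d))         ∎
  where open ≤-Reasoning

0<nCk : ∀ {n k} → k ≤ n → 0 < n C k
0<nCk {n} {k} k≤n = *-cancelˡ-< (k !) 0 (n C k) (begin-strict
  k ! * 0                   ≡⟨ *-zeroʳ (k !) ⟩
  0                         <⟨ 0<falling k≤n ⟩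
  falling n k               ≡⟨ k!*nCk≡falling n k ⟨
  k ! * (n C k)             ∎)
  where
  open ≤-Reasoning
  0<falling : ∀ {n k} → k ≤ n → 0 < falling n k
  0<falling z≤n       = ≤-refl
  0<falling (s≤s {n = n} k≤n) = *-mono-≤ (s≤s (z≤n {n})) (0<falling k≤n)

^-distribʳ-* : ∀ k m n → (m * n) ^ k ≡ m ^ k * n ^ k
^-distribʳ-* zero    m n = refl
^-distribʳ-* (suc k) m n = trans (cong (m * n *_) (^-distribʳ-* k m n))
  (solve 4 (λ m n x y → m :* n :* (x :* y) := m :* x :* (n :* y)) refl m n (m ^ k) (n ^ k))

-- Asymptotics of the edge count

-- Put s = a - k. From k! C(n,k) ≤ ((a + 1) b)^k and k! C(a,k) ≥ s^k follows C(n,k) ≤ (1 + c/s)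
-- C(a,k) b^k, so the relative deficit is at most c/s.
transversals-asymp : ∀ k m → ∃ λ N → ∀ a b n → N ≤ a → 1 ≤ b →
  a * b ≤ n → n ≤ suc a * b →
  m * (n C k ∸ (a C k) * b ^ k) < n C k
-- The perturbation is k + 1, since a + 1 = s + (k + 1).
transversals-asymp k m with c , h ← ^-perturb (suc k) k =
  -- This threshold gives s > m c, which brings the deficit c/s below 1/m.
  k + suc (m * c) , λ a b n N≤a 1≤b ab≤n n≤ →
    let
      open ≤-Reasoning
      T = (a C k) * b ^ k
      B = n C k
      s = a ∸ k
      k≤a = ≤-trans (m≤m+n k _) N≤a
      s+k≡a : s + k ≡ a
      s+k≡a = m∸n+n≡m k≤a
      mc<s : m * c < s
      mc<s = +-cancelʳ-≤ k (suc (m * c)) s (begin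
        suc (m * c) + k ≡⟨ +-comm (suc (m * c)) k ⟩
        k + suc (m * c) ≤⟨ N≤a ⟩
        a               ≡⟨ s+k≡a ⟨
        s + k           ∎)
      T≤B : T ≤ B
      T≤B = C-*-^≤C a b k n 1≤b ab≤n
      a≤ab : a ≤ a * b
      a≤ab = ≤-trans (≤-reflexive (sym (*-identityʳ a))) (*-monoʳ-≤ a 1≤b)
      0<B : 0 < B
      0<B = 0<nCk (≤-trans k≤a (≤-trans a≤ab ab≤n))
      sB≤T : s * B ≤ T * (s + c)
      sB≤T = *-cancelˡ-≤ (k !) ⦃ k !≢0 ⦄ (begin
        k ! * (s * B)                    ≡⟨ solve 3 (λ f s x → f :* (s :* x) := s :* (f :* x)) refl (k !) s B ⟩
        s * (k ! * B)                    ≡⟨ cong (s *_) (k!*nCk≡falling n k) ⟩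
        s * falling n k                  ≤⟨ *-monoʳ-≤ s (≤-trans (falling≤^ n k) (^-monoˡ-≤ k n≤)) ⟩
        s * (suc a * b) ^ k              ≡⟨ cong (s *_) (^-distribʳ-* k (suc a) b) ⟩
        s * (suc a ^ k * b ^ k)          ≡⟨ cong (λ z → s * (z ^ k * b ^ k)) (trans (cong suc (sym s+k≡a)) (sym (+-suc s k))) ⟩
        s * ((s + suc k) ^ k * b ^ k)    ≡⟨ *-assoc s _ _ ⟨
        s * (s + suc k) ^ k * b ^ k      ≤⟨ *-monoˡ-≤ (b ^ k) (h s (≤-trans (s≤s z≤n) mc<s)) ⟩
        s ^ k * (s + c) * b ^ k          ≤⟨ *-monoˡ-≤ (b ^ k) (*-monoˡ-≤ (s + c) (^≤falling s k)) ⟩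
        falling (s + k) k * (s + c) * b ^ k ≡⟨ cong (λ z → falling z k * (s + c) * b ^ k) s+k≡a ⟩
        falling a k * (s + c) * b ^ k    ≡⟨ cong (λ z → z * (s + c) * b ^ k) (k!*nCk≡falling a k) ⟨
        k ! * (a C k) * (s + c) * b ^ k  ≡⟨ solve 4 (λ f x y z → f :* x :* y :* z := f :* (x :* z :* y)) refl (k !) (a C k) (s + c) (b ^ k) ⟩
        k ! * (T * (s + c))              ∎)
      s[B∸T]≤ : s * (B ∸ T) ≤ B * c
      s[B∸T]≤ = begin
        s * (B ∸ T)           ≡⟨ *-distribˡ-∸ s B T ⟩
        s * B ∸ s * T         ≤⟨ ∸-monoˡ-≤ (s * T) sB≤T ⟩
        T * (s + c) ∸ s * T   ≡⟨ cong (_∸ s * T) (trans (*-distribˡ-+ T s c) (cong (_+ T * c) (*-comm T s))) ⟩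
        s * T + T * c ∸ s * T ≡⟨ m+n∸m≡n (s * T) (T * c) ⟩
        T * c                 ≤⟨ *-monoˡ-≤ c T≤B ⟩
        B * c                 ∎
    in *-cancelˡ-< s _ B (begin-strict
        s * (m * (B ∸ T)) ≡⟨ solve 3 (λ s m x → s :* (m :* x) := m :* (s :* x)) refl s m (B ∸ T) ⟩
        m * (s * (B ∸ T)) ≤⟨ *-monoʳ-≤ m s[B∸T]≤ ⟩
        m * (B * c)       ≡⟨ solve 3 (λ m x c → m :* (x :* c) := m :* c :* x) refl m B c ⟩
        m * c * B         <⟨ *-monoˡ-< B ⦃ >-nonZero 0<B ⦄ mc<s ⟩
        s * B             ∎)

-- In the application `x` counts cones, `y` stars, and `z` is the binomial coefficient. As x ≤ z,
-- the error is at most z - x if the sum falls short, and at most y otherwise.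
∣-∣-bound : ∀ m {x y z} → m * (z ∸ x) < z → m * y < z → x ≤ z → m * ∣ y + x - z ∣ < z
∣-∣-bound m {x} {y} {z} m[z∸x]<z my<z x≤z with ≤-total (y + x) z
... | inj₁ y+x≤z = ≤-<-trans (*-monoʳ-≤ m (begin
        ∣ y + x - z ∣ ≡⟨ m≤n⇒∣m-n∣≡n∸m y+x≤z ⟩
        z ∸ (y + x)   ≤⟨ ∸-monoʳ-≤ z (m≤n+m x y) ⟩
        z ∸ x         ∎)) m[z∸x]<z
  where open ≤-Reasoning
... | inj₂ z≤y+x = ≤-<-trans (*-monoʳ-≤ m (begin
        ∣ y + x - z ∣ ≡⟨ m≤n⇒∣n-m∣≡n∸m z≤y+x ⟩
        y + x ∸ z     ≤⟨ ∸-monoʳ-≤ (y + x) x≤z ⟩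
        y + x ∸ x     ≡⟨ m+n∸n≡m y x ⟩
        y             ∎)) my<z
  where open ≤-Reasoning

-- The case r = 1: there are only the n - 1 stars, so the error is 1.
star-asymp : ∀ m q → m ≤ q → m * ∣ q + 0 - (1 + q) C 1 ∣ < (1 + q) C 1
star-asymp m q m≤q rewrite nC1≡n (suc q) | +-identityʳ q | m≤n⇒∣m-n∣≡n∸m (n≤1+n q)
  | m+n∸n≡m 1 q | *-identityʳ m = s≤s m≤q

-- The cones fall short by little, by `transversals-asymp`. The stars are few because m q ≤ a (a +
-- 1) b < b² ≤ b^k ≤ C(a,k) b^k.
cone-asymp : ∀ k m → 2 ≤ k → ∃ λ N → ∀ a b q → N ≤ a → a * b ≤ q →
  k + q ≤ suc a * b → suc a * a < b →
  m * ∣ q + (a C k) * b ^ k - (k + q) C k ∣ < (k + q) C k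
cone-asymp k m 2≤k with N , asymp ← transversals-asymp k m =
  -- Besides N for the cones, a ≥ m bounds the factor m in the star estimate and a ≥ k makes C(a,k)
  -- positive.
  N ⊔ m ⊔ k , λ a b q N≤a ab≤q k+q≤ a²<b →
    let
      open ≤-Reasoning
      1≤b = ≤-trans (s≤s z≤n) a²<b
      ab≤n = ≤-trans ab≤q (m≤n+m q k)
      T≤ = C-*-^≤C a b k (k + q) 1≤b ab≤n
      N⊔m≤a = ≤-trans (m≤m⊔n (N ⊔ m) k) N≤a
      b≢0 = >-nonZero 1≤b
    in ∣-∣-bound m
      (asymp a b (k + q) (≤-trans (m≤m⊔n N m) N⊔m≤a) 1≤b ab≤n k+q≤)
      (begin-strict
        m * q           ≤⟨ *-mono-≤ (≤-trans (m≤n⊔m N m) N⊔m≤a) (≤-trans (m≤n+m q k) k+q≤) ⟩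
        a * (suc a * b) ≡⟨ solve 3 (λ x y z → x :* (y :* z) := z :* (y :* x)) refl a (suc a) b ⟩
        b * (suc a * a) <⟨ *-monoʳ-< b ⦃ b≢0 ⦄ a²<b ⟩
        b * b           ≡⟨ cong (b *_) (*-identityʳ b) ⟨
        b ^ 2           ≤⟨ ^-monoʳ-≤ b ⦃ b≢0 ⦄ 2≤k ⟩
        b ^ k           ≡⟨ *-identityˡ (b ^ k) ⟨
        1 * b ^ k       ≤⟨ *-monoˡ-≤ (b ^ k) (0<nCk (≤-trans (m≤n⊔m (N ⊔ m) k) N≤a)) ⟩
        (a C k) * b ^ k ≤⟨ T≤ ⟩
        (k + q) C k     ∎)
      T≤

-- Choice of the parameters

-- The three summands of blockSize r i give r + a ^ r ≤ b, hence n ≤ (a + 1) b, and make the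
-- fewer than (a + 1) b stars few compared with b ².
abstract
  blocks : ℕ → ℕ
  blocks i = suc i

  blockSize : ℕ → ℕ → ℕ
  blockSize r i = r + (blocks i ^ r + suc (blocks i) * blocks i)

  i<blocks : ∀ i → i < blocks i
  i<blocks i = ≤-refl

  blocks-mono : ∀ i → blocks i < blocks (suc i)
  blocks-mono i = ≤-refl

  blockSize-mono : ∀ r i → blockSize r i ≤ blockSize r (suc i)
  blockSize-mono r i = +-monoʳ-≤ r (+-mono-≤ (^-monoˡ-≤ r (n≤1+n (suc i)))
    (*-mono-≤ (n≤1+n (suc (suc i))) (n≤1+n (suc i))))

  blocks²<blockSize : ∀ r i → suc (blocks i) * blocks i < blockSize (suc r) i
  blocks²<blockSize r i = s≤s (≤-trans (m≤n+m (suc (blocks i) * blocks i) (blocks i ^ suc r)) (m≤n+m _ r))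

  rest≤blockSize : ∀ r i → r + blocks i ^ r ≤ blockSize r i
  rest≤blockSize r i = +-monoʳ-≤ r (m≤m+n (blocks i ^ r) _)

outerSize : ℕ → ℕ → ℕ
outerSize r i = blocks i ^ r + blocks i * blockSize r i

order : ℕ → ℕ → ℕ
order r i = r + outerSize r i

order≤ : ∀ r i → order r i ≤ suc (blocks i) * blockSize r i
order≤ r i = begin
  r + (blocks i ^ r + blocks i * blockSize r i) ≡⟨ +-assoc r (blocks i ^ r) _ ⟨
  r + blocks i ^ r + blocks i * blockSize r i   ≤⟨ +-monoˡ-≤ _ (rest≤blockSize r i) ⟩
  blockSize r i + blocks i * blockSize r i      ∎
  where open ≤-Reasoning

order-mono : ∀ r i → order (suc r) i < order (suc r) (suc i)
order-mono r i = +-monoʳ-< (suc r) (+-mono-≤-< (^-monoˡ-≤ (suc r) (<⇒≤ (blocks-mono i)))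
  (<-≤-trans (*-monoˡ-< (blockSize (suc r) i) ⦃ >-nonZero (≤-trans (s≤s z≤n) (blocks²<blockSize r i)) ⦄ (blocks-mono i))
    (*-monoʳ-≤ (blocks (suc i)) (blockSize-mono (suc r) i))))

-- For r = 1 a cone is an edge joining two tips of the star, which would close a cycle.
bases : ∀ r a → List (Choice r a)
bases r@(suc (suc _)) a = choices r a
bases _               a = []

size-asymp : ∀ r m → ∃ λ N → ∀ i → N ≤ i →
  m * ∣ outerSize (suc r) i + length (bases (suc r) (blocks i)) * blockSize (suc r) i ^ suc r
        - order (suc r) i C suc r ∣ < order (suc r) i C suc r
size-asymp zero    m = m , λ i m≤i → star-asymp m (outerSize 1 i) (begin
  m                     ≤⟨ m≤i ⟩
  i                     ≤⟨ <⇒≤ (i<blocks i) ⟩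
  blocks i              ≡⟨ *-identityʳ (blocks i) ⟨
  blocks i ^ 1          ≤⟨ m≤m+n (blocks i ^ 1) (blocks i * blockSize 1 i) ⟩
  outerSize 1 i         ∎)
  where open ≤-Reasoning
size-asymp (suc r) m =
  let N , asymp = cone-asymp (2 + r) m (s≤s (s≤s z≤n)) in
  N , λ i N≤i → subst
    (λ c → m * ∣ outerSize (2 + r) i + c * blockSize (2 + r) i ^ (2 + r) - order (2 + r) i C (2 + r) ∣
           < order (2 + r) i C (2 + r))
    (sym (length-choices (2 + r) (blocks i)))
    (asymp (blocks i) (blockSize (2 + r) i) (outerSize (2 + r) i)
      (≤-trans N≤i (<⇒≤ (i<blocks i)))
      (m≤n+m (blocks i * blockSize (2 + r) i) (blocks i ^ (2 + r)))
      (order≤ (2 + r) i)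
      (blocks²<blockSize (suc r) i))

bases-unique : ∀ r a → Unique (bases r a)
bases-unique zero          a = []
bases-unique (suc zero)    a = []
bases-unique (suc (suc r)) a = choices-unique (2 + r) a

bases-rank : ∀ r a {T} → T ∈ bases r a → 2 ≤ r
bases-rank (suc (suc r)) a _ = s≤s (s≤s z≤n)

outerVertex : ∀ r i → Fin (outerSize r i)
outerVertex r i = fromℕ< {0} (≤-trans
  (m^n>0 (blocks i) ⦃ >-nonZero (≤-trans (s≤s z≤n) (i<blocks i)) ⦄ r) (m≤m+n (blocks i ^ r) _))

-- Convergence is expressed without division: the quotient differs from 1 by less than 1/m for all
-- large i.
theorem4 : (k : ℕ) → 2 ≤ k →
    Σ (ℕ → ℕ) λ n → Σ ((i : ℕ) → Hypergraph k (n i)) λ H →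
    ((i : ℕ) → IsHypertree (H i)) ×
    ((i : ℕ) → n i < n (suc i)) ×
    ((m : ℕ) → 1 ≤ m → ∃ λ N → (i : ℕ) → N ≤ i →
    m * ∣ length (edges (H i)) - n i C (k ∸ 1) ∣ < n i C (k ∸ 1))
theorem4 (suc (suc r)) (s≤s (s≤s _)) =
  order (suc r) , graph , hypertree , order-mono r ,
  λ m _ → let N , asymp = size-asymp r m in
    N , λ i N≤i → subst (λ e → m * ∣ e - order (suc r) i C suc r ∣ < order (suc r) i C suc r)
      (sym (length-edges i)) (asymp i N≤i)
  where
  module G i = Construction.Graph r (blocks i) (blockSize (suc r) i) (bases (suc r) (blocks i))
    (bases-unique (suc r) (blocks i)) (bases-rank (suc r) (blocks i)) (outerVertex (suc r) i)
  open G
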